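{- Let $q$ be a prime power, $n$ a positive integer, and let $u_1,\dots,u_n$ and $v_1,\dots,v_n$ be a dual pair of ordered bases of $\mathbb{F}_{q^n}$ over $\mathbb{F}_q$. Let $f(x)\in\mathbb{F}_{q^n}[x]$ be a permutation polynomial over $\mathbb{F}_{q^n}$, put $f_i(x)=\mathrm{Tr}(v_if(x))$ for $1\le i\le n$, let $h_i(x)\in\mathbb{F}_q[x]$, $1\le i\le n$, be regarded as maps from $\mathbb{F}_q$ to $\mathbb{F}_q$, and let $a_1,\dots,a_n\in\mathbb{F}_{q^n}$. Then the polynomial $$F(x)=a_1h_1(f_1(x))+\dots+a_nh_n(f_n(x))$$ is a permutation polynomial over $\mathbb{F}_{q^n}$ if and only if the following two conditions hold: (1) $a_1,\dots,a_n$ is a basis of $\mathbb{F}_{q^n}$ over $\mathbb{F}_q$; (2) $h_i(x)$, $1\le i\le n$, are permutation polynomials over $\mathbb{F}_q$. Moreover, when these conditions hold, if $f^{ -1}(x)$ and $h_i^{ -1}(x)$ ($1\le i\le n$) are the compositional inverses of $f(x)$ and $h_i(x)$ respectively, and $b_1,\dots,b_n$ is the dual basis of $a_1,\dots,a_n$, then $$F^{ -1}(x)=f^{ -1}\left(\sum_{i=1}^nu_ih_i^{ -1}(\mathrm{Tr}(b_ix))\right).$$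
   Context: $\mathrm{Tr}(x)=x+x^q+\dots+x^{q^{n-1}}$ is the trace from $\mathbb{F}_{q^n}$ to $\mathbb{F}_q$. Two ordered bases $u_1,\dots,u_n$ and $v_1,\dots,v_n$ of $\mathbb{F}_{q^n}$ over $\mathbb{F}_q$ are dual if $\mathrm{Tr}(u_iv_j)=1$ when $i=j$ and $0$ otherwise. A polynomial over a finite field $K$ is identified with the map $K\to K$ it induces (i.e. taken modulo $x^{|K|}-x$); it is a permutation polynomial over $K$ if this map is a bijection, and its compositional inverse is the polynomial (modulo $x^{|K|}-x$) inducing the inverse map. -}

module Defs where

open import Algebra.Bundles using (CommutativeRing; RawRing; RawSemiring)
open import Algebra.Morphism.Bundles using (RingHomomorphism)
import Algebra.Definitions as Definitions
import Algebra.Definitions.RawSemiring as RawSemiringDefinitions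
open import Data.Fin.Base using (Fin; toℕ)
open import Data.List.Base using (List; []; _∷_; map)
open import Data.Nat.Base as ℕ using (ℕ)
open import Data.Nat.Primality using (Prime)
open import Data.Product.Base using (∃; ∃₂; _×_)
open import Data.Vec.Functional using (Vector)
open import Function.Bundles using (Inverse)
open import Function.Definitions using (Bijective; Inverseᵇ)
open import Level using (Level; _⊔_) renaming (suc to lsuc)
open import Relation.Binary.PropositionalEquality using (_≡_; _≢_; setoid)

PrimePower : ℕ → Set
PrimePower q = ∃₂ λ p e → Prime p × 0 ℕ.< e × q ≡ p ℕ.^ e

record IsField {c ℓ : Level} (R : CommutativeRing c ℓ) : Set (c ⊔ ℓ) where
  open CommutativeRing R
  open Definitions _≈_ using (Invertible)
  field
    1≉0     : 1# ≉ 0#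
    inverse : ∀ x → x ≉ 0# → Invertible 1# _*_ x

record FiniteField (c ℓ : Level) (order : ℕ) : Set (lsuc (c ⊔ ℓ)) where
  field
    commutativeRing : CommutativeRing c ℓ
    isField         : IsField commutativeRing
    enumeration     : Inverse (setoid (Fin order)) (CommutativeRing.setoid commutativeRing)

  open CommutativeRing commutativeRing public
  open RawRing rawRing public using (rawSemiring)
  open IsField isField public

-- x + x^q + ⋯ + x^(q^(n-1)) in any semiring, so that the same formula applies
-- both to elements of a field and to polynomials over it.
trace : {c ℓ : Level} (R : RawSemiring c ℓ) (q n : ℕ) →
        RawSemiring.Carrier R → RawSemiring.Carrier R
trace R q n x = sum {n} λ i → x ^ (q ℕ.^ toℕ i)
  where open RawSemiringDefinitions R using (sum; _^_)

-- Polynomials are lists of coefficients, constant term first; trailing zeros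
-- are allowed.
module Polynomial {c ℓ : Level} (R : RawSemiring c ℓ) where

  open RawSemiring R

  Poly : Set c
  Poly = List Carrier

  ⟦_⟧ : Poly → Carrier → Carrier
  ⟦ []    ⟧ x = 0#
  ⟦ a ∷ p ⟧ x = a + x * ⟦ p ⟧ x

  const : Carrier → Poly
  const a = a ∷ []

  X : Poly
  X = 0# ∷ 1# ∷ []

  infixl 6 _+ₚ_
  _+ₚ_ : Poly → Poly → Poly
  []      +ₚ q       = q
  (a ∷ p) +ₚ []      = a ∷ p
  (a ∷ p) +ₚ (b ∷ q) = (a + b) ∷ (p +ₚ q)

  infixl 7 _*ₚ_
  _*ₚ_ : Poly → Poly → Poly
  []      *ₚ q = []
  (a ∷ p) *ₚ q = map (a *_) q +ₚ (0# ∷ (p *ₚ q))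

  infixr 9 _∘ₚ_
  _∘ₚ_ : Poly → Poly → Poly
  []      ∘ₚ q = []
  (a ∷ p) ∘ₚ q = const a +ₚ q *ₚ (p ∘ₚ q)

  -- Polynomials are identified when they induce the same map; over a finite
  -- field K this is congruence modulo x^|K| - x.
  infix 4 _≈ₚ_
  _≈ₚ_ : Poly → Poly → Set (c ⊔ ℓ)
  p ≈ₚ q = ∀ x → ⟦ p ⟧ x ≈ ⟦ q ⟧ x

  polyRawSemiring : RawSemiring c (c ⊔ ℓ)
  polyRawSemiring = record
    { Carrier = Poly
    ; _≈_     = _≈ₚ_
    ; _+_     = _+ₚ_
    ; _*_     = _*ₚ_
    ; 0#      = []
    ; 1#      = const 1#
    }

  open RawSemiringDefinitions polyRawSemiring public using () renaming (sum to sumₚ)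

  IsPermutationPolynomial : Poly → Set (c ⊔ ℓ)
  IsPermutationPolynomial p = Bijective _≈_ _≈_ ⟦ p ⟧

  IsCompositionalInverse : Poly → Poly → Set (c ⊔ ℓ)
  IsCompositionalInverse p p⁻¹ = Inverseᵇ _≈_ _≈_ ⟦ p ⟧ ⟦ p⁻¹ ⟧

-- The inclusion 𝔽_q ⊆ 𝔽_{q^n} is a unital ring homomorphism ι, which is
-- automatically injective as its source is a field.
module Extension
  {k ℓk l ℓl : Level} {q n : ℕ}
  (K : FiniteField k ℓk q) (L : FiniteField l ℓl (q ℕ.^ n))
  (ι : RingHomomorphism (FiniteField.rawRing K) (FiniteField.rawRing L))
  where

  private
    module K = FiniteField K
    module L = FiniteField L
  open RingHomomorphism ι using () renaming (⟦_⟧ to embed)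
  open RawSemiringDefinitions L.rawSemiring using (sum)

  module K[X] = Polynomial K.rawSemiring
  module L[X] = Polynomial L.rawSemiring

  baseChange : K[X].Poly → L[X].Poly
  baseChange = map embed

  -- The trace to K, as an element of L.
  Tr : L.Carrier → L.Carrier
  Tr = trace L.rawSemiring q n

  Trₚ : L[X].Poly → L[X].Poly
  Trₚ = trace L[X].polyRawSemiring q n

  linearCombination : Vector K.Carrier n → Vector L.Carrier n → L.Carrier
  linearCombination c u = sum λ i → embed (c i) L.* u i

  LinearlyIndependent : Vector L.Carrier n → Set (k ⊔ ℓk ⊔ ℓl)
  LinearlyIndependent u = ∀ c → linearCombination c u L.≈ L.0# → ∀ i → c i K.≈ K.0#

  Spanning : Vector L.Carrier n → Set (k ⊔ l ⊔ ℓl)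
  Spanning u = ∀ x → ∃ λ c → linearCombination c u L.≈ x

  IsBasis : Vector L.Carrier n → Set (k ⊔ ℓk ⊔ l ⊔ ℓl)
  IsBasis u = LinearlyIndependent u × Spanning u

  record AreDualBases (u v : Vector L.Carrier n) : Set (k ⊔ ℓk ⊔ l ⊔ ℓl) where
    field
      basisˡ     : IsBasis u
      basisʳ     : IsBasis v
      diagonal    : ∀ i → Tr (u i L.* v i) L.≈ L.1#
      offDiagonal : ∀ i j → i ≢ j → Tr (u i L.* v j) L.≈ L.0#

{-# OPTIONS --safe #-}
module Submission where

-- Writing y = Σ cᵢ uᵢ, duality and the K-linearity of the trace give Tr (vᵢ y) = cᵢ.
-- Hence if f(x) has coordinates c in the basis u, then F(x) = Σ hᵢ(cᵢ) aᵢ, and F is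
-- the composite of the bijections f and y ↦ c with the map c ↦ Σ hᵢ(cᵢ) aᵢ on Kⁿ.
-- Varying one coordinate shows that each hᵢ is injective if F is, hence bijective as K
-- is finite; then c ↦ Σ cᵢ aᵢ is a bijection too. The inner sum of the formula for F⁻¹
-- has the same shape as F, with X, (a, b), hᵢ⁻¹ and u in the roles of f, (u, v), hᵢ and a.
-- The trace is additive because x ↦ x^p is, the characteristic p being read off from
-- |L| · 1 = 0, and K-linear because c^q = c for c in K.

open import Defs
open import Algebra.Bundles using (CommutativeSemiring)
open import Algebra.Morphism.Bundles using (RingHomomorphism)
import Algebra.Properties.CommutativeMonoid.Sum as CommutativeMonoidSum
import Algebra.Properties.CommutativeSemigroup as CommutativeSemigroupProperties
import Algebra.Properties.CommutativeSemiring.Binomial as Binomial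
import Algebra.Properties.CommutativeSemiring.Exp as Exp
import Algebra.Properties.Group as GroupProperties
import Algebra.Properties.Semiring.Mult as Mult
import Algebra.Properties.Semiring.Sum as Sum
open import Data.Fin.Base using (Fin; zero; suc; toℕ; fromℕ; inject₁)
open import Data.Fin.Permutation using (Permutation′; permutation)
open import Data.Fin.Properties
  using (_≟_; any?; injective⇒≤; punchInᵢ≢i; punchOut-injective; toℕ-fromℕ; toℕ-inject₁; toℕ<n)
open import Data.List.Base using ([]; _∷_; map)
open import Data.Nat.Base as ℕ using (ℕ; zero; suc; s≤s; z≤n; _<_; _^_; _!; NonZero)
open import Data.Nat.Combinatorics using (_C_; nCn≡1; nCk≡n!/k![n-k]!; k![n∸k]!∣n!)
open import Data.Nat.Divisibility using (_∣_; _∤_; divides-refl; m∣m*n; >⇒∤)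
open import Data.Nat.DivMod using (m/n*n≡m)
open import Data.Nat.Primality using (Prime; prime⇒nonTrivial; euclidsLemma; ¬prime[0]; ¬prime[1])
import Data.Nat.Properties as ℕ
open import Data.Product.Base using (∃; _×_; _,_; proj₁; proj₂; map₂)
open import Data.Sum.Base using (inj₁; inj₂)
open import Data.Vec.Functional using (Vector; tail; init; replicate; updateAt; removeAt)
open import Data.Vec.Functional.Properties using (updateAt-updates; updateAt-minimal)
open import Function.Base using (_∘_)
open import Function.Bundles using (_⇔_; mk⇔; Inverse)
open import Function.Definitions using (Injective; StrictlySurjective; Congruent)
open import Function.Properties.Inverse using (Inverse⇒Injection) renaming (sym to flip)
open import Level using (Level)
open import Relation.Binary.Definitions using (Decidable)
open import Relation.Binary.PropositionalEquality as ≡ using (_≡_; _≢_)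
import Relation.Binary.Reasoning.Setoid as ≈-Reasoning
open import Relation.Nullary.Decidable using (yes; no; via-injection)
open import Relation.Nullary.Negation using (contradiction)

private
  variable
    c ℓ : Level

-- Preliminaries: prime divisors of binomial coefficients, and injections of a finite set into
-- itself.

prime∤! : ∀ {p} → Prime p → ∀ {k} → k < p → p ∤ k !
prime∤! pr {zero}  k<p p∣1 = >⇒∤ (ℕ.nonTrivial⇒n>1 _ {{prime⇒nonTrivial pr}}) p∣1
prime∤! pr {suc k} k<p p∣k! with euclidsLemma (suc k) (k !) pr p∣k!
... | inj₁ p∣k+1 = >⇒∤ k<p p∣k+1
... | inj₂ p∣k!′ = prime∤! pr (ℕ.<⇒≤ k<p) p∣k!′

nCk*k![n∸k]!≡n! : ∀ {n k} → k ℕ.≤ n → (n C k) ℕ.* (k ! ℕ.* (n ℕ.∸ k) !) ≡ n !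
nCk*k![n∸k]!≡n! {n} {k} k≤n =
  ≡.trans (≡.cong (ℕ._* (k ! ℕ.* (n ℕ.∸ k) !)) (nCk≡n!/k![n-k]! k≤n)) (m/n*n≡m (k![n∸k]!∣n! k≤n))
  where instance _ = k ℕ.!* (n ℕ.∸ k) !≢0

-- The prime divides `p !`, which is the product of `p C k`, `k !` and `(p ∸ k) !`. The two
-- factorials have only factors below `p`, so by Euclid's lemma the binomial coefficient is the one
-- divisible by `p`.
prime∣C : ∀ {p k} → Prime p → 0 < k → k < p → p ∣ p C k
prime∣C {p@(suc p-1)} {k} pr 0<k k<p
  with euclidsLemma (p C k) (k ! ℕ.* (p ℕ.∸ k) !) pr
         (≡.subst (p ∣_) (≡.sym (nCk*k![n∸k]!≡n! (ℕ.<⇒≤ k<p))) (m∣m*n (p-1 !)))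
... | inj₁ p∣C = p∣C
... | inj₂ p∣k![p-k]! with euclidsLemma (k !) ((p ℕ.∸ k) !) pr p∣k![p-k]!
...   | inj₁ p∣k!     = contradiction p∣k! (prime∤! pr k<p)
...   | inj₂ p∣[p-k]! = contradiction p∣[p-k]! (prime∤! pr (ℕ.∸-monoʳ-< 0<k (ℕ.<⇒≤ k<p)))

-- If `y` were missed, deleting it from the codomain would turn `f` into an injection from `m + 1`
-- points to `m` points.
injective⇒strictlySurjective : ∀ {m} {f : Fin m → Fin m} →
                               Injective _≡_ _≡_ f → StrictlySurjective _≡_ f
injective⇒strictlySurjective {suc m} {f} inj y with any? (λ x → f x ≟ y)
... | yes fx≡y = fx≡y
... | no  y∉im = contradiction (injective⇒≤ (inj ∘ punchOut-injective (y≢f _) (y≢f _))) ℕ.1+n≰n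
  where
  y≢f : ∀ x → y ≢ f x
  y≢f x y≡fx = y∉im (x , ≡.sym y≡fx)

-- Sums, multiples of 1, and the Frobenius map in characteristic p.

module SemiringProperties (S : CommutativeSemiring c ℓ) where

  open CommutativeSemiring S hiding (zero)
  open Sum semiring
  open Mult semiring using (×-congˡ; ×-congʳ; ×-homo-1; ×-assocˡ; ×-assoc-*; ×1-homo-*)
    renaming (_×_ to _×ᵣ_)
  open Exp S using (^-congˡ; ^-assocʳ) renaming (_^_ to _^ᵣ_)
  open ≈-Reasoning setoid

  sum-single : ∀ {n} (t : Vector Carrier n) i → (∀ j → i ≢ j → t j ≈ 0#) → sum t ≈ t i
  sum-single {suc n} t i t≈0 = begin
    sum t                         ≈⟨ sum-remove t ⟩
    t i + sum (removeAt t i)      ≈⟨ +-congˡ (sum-cong-≋ λ j → t≈0 _ (punchInᵢ≢i i j ∘ ≡.sym)) ⟩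
    t i + sum (replicate n 0#)    ≈⟨ +-congˡ (sum-replicate-zero n) ⟩
    t i + 0#                      ≈⟨ +-identityʳ _ ⟩
    t i                           ∎

  ×1≈0⇒×≈0 : ∀ {n} → n ×ᵣ 1# ≈ 0# → ∀ x → n ×ᵣ x ≈ 0#
  ×1≈0⇒×≈0 {n} n≈0 x = begin
    n ×ᵣ x          ≈⟨ ×-congʳ n (*-identityˡ x) ⟨
    n ×ᵣ (1# * x)   ≈⟨ ×-assoc-* n 1# x ⟨
    (n ×ᵣ 1#) * x   ≈⟨ *-congʳ n≈0 ⟩
    0# * x          ≈⟨ zeroˡ x ⟩
    0#              ∎

  ∣⇒×≈0 : ∀ {p n} → p ×ᵣ 1# ≈ 0# → p ∣ n → ∀ x → n ×ᵣ x ≈ 0#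
  ∣⇒×≈0 {p} p≈0 (divides-refl k) x = begin
    (k ℕ.* p) ×ᵣ x   ≈⟨ ×-congˡ (ℕ.*-comm k p) ⟩
    (p ℕ.* k) ×ᵣ x   ≈⟨ ×-assocˡ x p k ⟨
    p ×ᵣ (k ×ᵣ x)    ≈⟨ ×1≈0⇒×≈0 {p} p≈0 _ ⟩
    0#               ∎

  -- Turns the vanishing of a prime power times 1 into the vanishing of a power of `p ×ᵣ 1#`, from
  -- which the characteristic of a field can be read off.
  ×1-homo-^ : ∀ p k → (p ^ k) ×ᵣ 1# ≈ (p ×ᵣ 1#) ^ᵣ k
  ×1-homo-^ p zero    = ×-homo-1 1#
  ×1-homo-^ p (suc k) = trans (×1-homo-* p (p ^ k)) (*-congˡ (×1-homo-^ p k))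

  0^ : ∀ n .{{_ : NonZero n}} → 0# ^ᵣ n ≈ 0#
  0^ (suc n) = zeroˡ _

  ^-fixed : ∀ {x m} → x ^ᵣ m ≈ x → ∀ i → x ^ᵣ (m ^ i) ≈ x
  ^-fixed         eq zero    = *-identityʳ _
  ^-fixed {x} {m} eq (suc i) = begin
    x ^ᵣ (m ℕ.* m ^ i)   ≈⟨ ^-assocʳ x m (m ^ i) ⟨
    (x ^ᵣ m) ^ᵣ (m ^ i)  ≈⟨ ^-congˡ (m ^ i) eq ⟩
    x ^ᵣ (m ^ i)         ≈⟨ ^-fixed eq i ⟩
    x                    ∎

  module Characteristic {p} (pr : Prime p) (p×1≈0 : p ×ᵣ 1# ≈ 0#) where

    -- In the binomial expansion only the two extreme terms survive: the inner coefficients are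
    -- divisible by `p`, and `p` annihilates every element.
    frobenius-+ : ∀ x y → (x + y) ^ᵣ p ≈ x ^ᵣ p + y ^ᵣ p
    frobenius-+ x y = go p pr ≡.refl
      where
      -- The equation `p ≡ p′` allows a case split on the fixed exponent. Neither 0 nor 1 is prime,
      -- and for `p = m + 2` the expansion consists of a first term, `m + 1` inner terms and a last
      -- term.
      go : ∀ p′ → Prime p′ → p ≡ p′ → (x + y) ^ᵣ p′ ≈ x ^ᵣ p′ + y ^ᵣ p′
      go zero            pr′ _ = contradiction pr′ ¬prime[0]
      go (suc zero)      pr′ _ = contradiction pr′ ¬prime[1]
      go (suc (suc m)) pr′ ≡.refl = begin
        (x + y) ^ᵣ p                                  ≈⟨ Binomial.theorem S p x y ⟩
        t zero + sum (tail t)                         ≈⟨ +-congˡ (sum-init-last (tail t)) ⟩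
        t zero + (sum (init (tail t)) + t (fromℕ p))  ≈⟨ +-cong first (+-cong middle final) ⟩
        y ^ᵣ p + (0# + x ^ᵣ p)                        ≈⟨ +-congˡ (+-identityˡ _) ⟩
        y ^ᵣ p + x ^ᵣ p                               ≈⟨ +-comm _ _ ⟩
        x ^ᵣ p + y ^ᵣ p                               ∎
        where
        t = Binomial.binomialTerm S x y p

        first : t zero ≈ y ^ᵣ p
        first = trans (×-homo-1 _) (*-identityˡ _)

        final : t (fromℕ p) ≈ x ^ᵣ p
        final = begin
          t (fromℕ p)
            ≡⟨ ≡.cong (λ k → (p C k) ×ᵣ (x ^ᵣ k * y ^ᵣ (p ℕ.∸ k))) (toℕ-fromℕ p) ⟩
          (p C p) ×ᵣ (x ^ᵣ p * y ^ᵣ (p ℕ.∸ p))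
            ≡⟨ ≡.cong₂ (λ n k → n ×ᵣ (x ^ᵣ p * y ^ᵣ k)) (nCn≡1 p) (ℕ.n∸n≡0 p) ⟩
          1 ×ᵣ (x ^ᵣ p * 1#)
            ≈⟨ ×-homo-1 _ ⟩
          x ^ᵣ p * 1#
            ≈⟨ *-identityʳ _ ⟩
          x ^ᵣ p ∎

        -- Dropping the first term shifts the index, so inner term `i` carries the coefficient
        -- `p C (i + 1)`; here `i < m + 1` places `i + 1` strictly between 0 and `p`.
        middle : sum (init (tail t)) ≈ 0#
        middle = trans
          (sum-cong-≋ {suc m} λ i → ∣⇒×≈0 p×1≈0 (prime∣C pr′ (s≤s z≤n)
            (s≤s (≡.subst (_< suc m) (≡.sym (toℕ-inject₁ i)) (toℕ<n i))))
            (Binomial.binomial S x y p (suc (inject₁ i))))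
          (sum-replicate-zero (suc m))

    frobenius^-+ : ∀ j x y → (x + y) ^ᵣ (p ^ j) ≈ x ^ᵣ (p ^ j) + y ^ᵣ (p ^ j)
    frobenius^-+ zero    x y = trans (*-identityʳ _) (sym (+-cong (*-identityʳ _) (*-identityʳ _)))
    frobenius^-+ (suc j) x y = begin
      (x + y) ^ᵣ (p ℕ.* p ^ j)                     ≈⟨ ^-assocʳ _ p (p ^ j) ⟨
      ((x + y) ^ᵣ p) ^ᵣ (p ^ j)                    ≈⟨ ^-congˡ (p ^ j) (frobenius-+ x y) ⟩
      (x ^ᵣ p + y ^ᵣ p) ^ᵣ (p ^ j)                 ≈⟨ frobenius^-+ j _ _ ⟩
      (x ^ᵣ p) ^ᵣ (p ^ j) + (y ^ᵣ p) ^ᵣ (p ^ j)    ≈⟨ +-cong (^-assocʳ x p (p ^ j)) (^-assocʳ y p (p ^ j)) ⟩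
      x ^ᵣ (p ℕ.* p ^ j) + y ^ᵣ (p ℕ.* p ^ j)      ∎

-- Evaluation of polynomials commutes with the polynomial operations.

module PolynomialProperties (S : CommutativeSemiring c ℓ) where

  open CommutativeSemiring S hiding (zero)
  open Polynomial rawSemiring
  open import Algebra.Definitions.RawSemiring polyRawSemiring using () renaming (_^_ to _^ₚ_)
  open Sum semiring using (sum; sum-cong-≋)
  open Exp S using () renaming (_^_ to _^ᵣ_)
  open ≈-Reasoning setoid

  ⟦⟧-cong : ∀ p → Congruent _≈_ _≈_ ⟦ p ⟧
  ⟦⟧-cong []      x≈y = refl
  ⟦⟧-cong (a ∷ p) x≈y = +-congˡ (*-cong x≈y (⟦⟧-cong p x≈y))

  ⟦const⟧ : ∀ a x → ⟦ const a ⟧ x ≈ a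
  ⟦const⟧ a x = trans (+-congˡ (zeroʳ x)) (+-identityʳ a)

  ⟦X⟧ : ∀ x → ⟦ X ⟧ x ≈ x
  ⟦X⟧ x = trans (+-identityˡ _) (trans (*-congˡ (⟦const⟧ 1# x)) (*-identityʳ x))

  ⟦+⟧ : ∀ p q x → ⟦ p +ₚ q ⟧ x ≈ ⟦ p ⟧ x + ⟦ q ⟧ x
  ⟦+⟧ []      q       x = sym (+-identityˡ _)
  ⟦+⟧ (a ∷ p) []      x = sym (+-identityʳ _)
  ⟦+⟧ (a ∷ p) (b ∷ q) x = begin
    (a + b) + x * ⟦ p +ₚ q ⟧ x             ≈⟨ +-congˡ (*-congˡ (⟦+⟧ p q x)) ⟩
    (a + b) + x * (⟦ p ⟧ x + ⟦ q ⟧ x)      ≈⟨ +-congˡ (distribˡ x _ _) ⟩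
    (a + b) + (x * ⟦ p ⟧ x + x * ⟦ q ⟧ x)  ≈⟨ interchange a b _ _ ⟩
    ⟦ a ∷ p ⟧ x + ⟦ b ∷ q ⟧ x              ∎
    where open CommutativeSemigroupProperties +-commutativeSemigroup using (interchange)

  ⟦scale⟧ : ∀ a p x → ⟦ map (a *_) p ⟧ x ≈ a * ⟦ p ⟧ x
  ⟦scale⟧ a []      x = sym (zeroʳ a)
  ⟦scale⟧ a (b ∷ p) x = begin
    a * b + x * ⟦ map (a *_) p ⟧ x  ≈⟨ +-congˡ (*-congˡ (⟦scale⟧ a p x)) ⟩
    a * b + x * (a * ⟦ p ⟧ x)       ≈⟨ +-congˡ (x∙yz≈y∙xz x a _) ⟩
    a * b + a * (x * ⟦ p ⟧ x)       ≈⟨ distribˡ a b _ ⟨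
    a * ⟦ b ∷ p ⟧ x                 ∎
    where open CommutativeSemigroupProperties *-commutativeSemigroup using (x∙yz≈y∙xz)

  ⟦*⟧ : ∀ p q x → ⟦ p *ₚ q ⟧ x ≈ ⟦ p ⟧ x * ⟦ q ⟧ x
  ⟦*⟧ []      q x = sym (zeroˡ _)
  ⟦*⟧ (a ∷ p) q x = begin
    ⟦ map (a *_) q +ₚ (0# ∷ p *ₚ q) ⟧ x          ≈⟨ ⟦+⟧ (map (a *_) q) (0# ∷ p *ₚ q) x ⟩
    ⟦ map (a *_) q ⟧ x + (0# + x * ⟦ p *ₚ q ⟧ x) ≈⟨ +-cong (⟦scale⟧ a q x) (+-identityˡ _) ⟩
    a * ⟦ q ⟧ x + x * ⟦ p *ₚ q ⟧ x               ≈⟨ +-congˡ (*-congˡ (⟦*⟧ p q x)) ⟩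
    a * ⟦ q ⟧ x + x * (⟦ p ⟧ x * ⟦ q ⟧ x)        ≈⟨ +-congˡ (*-assoc x _ _) ⟨
    a * ⟦ q ⟧ x + x * ⟦ p ⟧ x * ⟦ q ⟧ x          ≈⟨ distribʳ _ a _ ⟨
    ⟦ a ∷ p ⟧ x * ⟦ q ⟧ x                        ∎

  ⟦const*⟧ : ∀ a p x → ⟦ const a *ₚ p ⟧ x ≈ a * ⟦ p ⟧ x
  ⟦const*⟧ a p x = trans (⟦*⟧ (const a) p x) (*-congʳ (⟦const⟧ a x))

  ⟦∘⟧ : ∀ p q x → ⟦ p ∘ₚ q ⟧ x ≈ ⟦ p ⟧ (⟦ q ⟧ x)
  ⟦∘⟧ []      q x = refl
  ⟦∘⟧ (a ∷ p) q x = begin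
    ⟦ const a +ₚ q *ₚ (p ∘ₚ q) ⟧ x
      ≈⟨ ⟦+⟧ (const a) (q *ₚ (p ∘ₚ q)) x ⟩
    ⟦ const a ⟧ x + ⟦ q *ₚ (p ∘ₚ q) ⟧ x
      ≈⟨ +-cong (⟦const⟧ a x) (⟦*⟧ q (p ∘ₚ q) x) ⟩
    a + ⟦ q ⟧ x * ⟦ p ∘ₚ q ⟧ x
      ≈⟨ +-congˡ (*-congˡ (⟦∘⟧ p q x)) ⟩
    a + ⟦ q ⟧ x * ⟦ p ⟧ (⟦ q ⟧ x) ∎

  ⟦^⟧ : ∀ p k x → ⟦ p ^ₚ k ⟧ x ≈ ⟦ p ⟧ x ^ᵣ k
  ⟦^⟧ p zero    x = ⟦const⟧ 1# x
  ⟦^⟧ p (suc k) x = trans (⟦*⟧ p (p ^ₚ k) x) (*-congˡ (⟦^⟧ p k x))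

  ⟦sum⟧ : ∀ {n} (p : Vector Poly n) x → ⟦ sumₚ p ⟧ x ≈ sum (λ i → ⟦ p i ⟧ x)
  ⟦sum⟧ {zero}  p x = refl
  ⟦sum⟧ {suc n} p x = trans (⟦+⟧ (p zero) (sumₚ (tail p)) x) (+-congˡ (⟦sum⟧ (tail p) x))

  -- Both sides are the same formula over two semirings, and evaluation respects the sums and powers
  -- in it.
  ⟦trace⟧ : ∀ q n p x → ⟦ trace polyRawSemiring q n p ⟧ x ≈ trace rawSemiring q n (⟦ p ⟧ x)
  ⟦trace⟧ q n p x = trans (⟦sum⟧ {n} (λ i → p ^ₚ (q ^ toℕ i)) x)
                          (sum-cong-≋ {n} λ i → ⟦^⟧ p (q ^ toℕ i) x)

-- Finite fields: counting arguments, cancellation and characteristic.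

module FiniteFieldProperties {m} (F : FiniteField c ℓ m) where

  open FiniteField F hiding (zero)
  open Inverse enumeration using (from-cong)
    renaming (to to element; from to index)
  open Inverse enumeration public using ()
    renaming (strictlyInverseˡ to element-index; strictlyInverseʳ to index-element)
  open Sum semiring
  open Mult semiring using () renaming (_×_ to _×ᵣ_)
  open Exp commutativeSemiring using () renaming (_^_ to _^ᵣ_)
  open CommutativeMonoidSum *-commutativeMonoid using () renaming (sum to product)
  open GroupProperties +-group using (//-rightDividesˡ; //-rightDividesʳ; ∙-cancelˡ)
  open SemiringProperties commutativeSemiring
  open ≈-Reasoning setoid

  infix 4 _≈?_
  _≈?_ : Decidable _≈_
  _≈?_ = via-injection (Inverse⇒Injection (flip enumeration)) _≟_

  -- Conjugating by the enumeration gives an injective map of `Fin m` to itself, where the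
  -- pigeonhole principle applies.
  injective⇒surjective : ∀ {f} → Congruent _≈_ _≈_ f →
                         Injective _≈_ _≈_ f → StrictlySurjective _≈_ f
  injective⇒surjective {f} f-cong f-inj y = element (proj₁ preimage) , (begin
    f (element (proj₁ preimage))                    ≈⟨ element-index _ ⟨
    element (index (f (element (proj₁ preimage))))  ≡⟨ ≡.cong element (proj₂ preimage) ⟩
    element (index y)                               ≈⟨ element-index y ⟩
    y                                               ∎)
    where
    index-injective : Injective _≈_ _≡_ index
    index-injective eq = trans (sym (element-index _)) (trans (reflexive (≡.cong element eq)) (element-index _))

    element-injective : Injective _≡_ _≈_ element
    element-injective eq = ≡.trans (≡.sym (index-element _)) (≡.trans (from-cong eq) (index-element _))

    preimage : ∃ λ i → index (f (element i)) ≡ index y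
    preimage = injective⇒strictlySurjective (element-injective ∘ f-inj ∘ index-injective) (index y)

  -- Sums and products over the field are indexed by `Fin m`; this makes a bijection of the field
  -- available for reindexing them.
  bijection⇒permutation : (f g : Carrier → Carrier) → Congruent _≈_ _≈_ f → Congruent _≈_ _≈_ g →
                          (∀ x → f (g x) ≈ x) → (∀ x → g (f x) ≈ x) → Permutation′ m
  bijection⇒permutation f g f-cong g-cong fg gf = permutation
    (index ∘ f ∘ element) (index ∘ g ∘ element) (cancel f g f-cong fg) (cancel g f g-cong gf)
    where
    cancel : (f g : Carrier → Carrier) → Congruent _≈_ _≈_ f → (∀ x → f (g x) ≈ x) →
             ∀ i → index (f (element (index (g (element i))))) ≡ i
    cancel f g f-cong fg i = ≡.trans
      (from-cong (trans (f-cong (element-index _)) (fg _))) (index-element i)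

  -- Translation by 1 permutes the field, so the sum of all elements is unchanged when `m` copies of
  -- 1 are added to it.
  order×1≈0 : m ×ᵣ 1# ≈ 0#
  order×1≈0 = ∙-cancelˡ (sum element) _ _ (begin
    sum element + m ×ᵣ 1#             ≈⟨ +-congˡ (sum-replicate m) ⟨
    sum element + sum (replicate m 1#) ≈⟨ ∑-distrib-+ element _ ⟨
    sum (λ i → element i + 1#)        ≈⟨ sum-cong-≋ {m} (λ i → element-index _) ⟨
    sum (λ i → element (index (element i + 1#))) ≈⟨ sum-permute element shift ⟨
    sum element                       ≈⟨ +-identityʳ _ ⟨
    sum element + 0#                  ∎)
    where
    shift : Permutation′ m
    shift = bijection⇒permutation (_+ 1#) (_- 1#) +-congʳ +-congʳ
              (//-rightDividesˡ 1#) (//-rightDividesʳ 1#)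

  *≈0⇒≈0 : ∀ {x y} → x ≉ 0# → x * y ≈ 0# → y ≈ 0#
  *≈0⇒≈0 {x} {y} x≉0 xy≈0 with x⁻¹ , x⁻¹x≈1 , _ ← inverse x x≉0 = begin
    y               ≈⟨ *-identityˡ y ⟨
    1# * y          ≈⟨ *-congʳ x⁻¹x≈1 ⟨
    x⁻¹ * x * y     ≈⟨ *-assoc _ _ _ ⟩
    x⁻¹ * (x * y)   ≈⟨ *-congˡ xy≈0 ⟩
    x⁻¹ * 0#        ≈⟨ zeroʳ _ ⟩
    0#              ∎

  *-cancelʳ : ∀ {x y z} → z ≉ 0# → x * z ≈ y * z → x ≈ y
  *-cancelʳ {x} {y} {z} z≉0 xz≈yz with z⁻¹ , _ , zz⁻¹≈1 ← inverse z z≉0 = begin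
    x               ≈⟨ undo x ⟨
    x * z * z⁻¹     ≈⟨ *-congʳ xz≈yz ⟩
    y * z * z⁻¹     ≈⟨ undo y ⟩
    y               ∎
    where
    undo : ∀ w → w * z * z⁻¹ ≈ w
    undo w = trans (*-assoc _ _ _) (trans (*-congˡ zz⁻¹≈1) (*-identityʳ w))

  product-≉0 : ∀ {n} (t : Vector Carrier n) → (∀ i → t i ≉ 0#) → product t ≉ 0#
  product-≉0 {zero}  t t≉0 = 1≉0
  product-≉0 {suc n} t t≉0 = product-≉0 (tail t) (t≉0 ∘ suc) ∘ *≈0⇒≈0 (t≉0 zero)

  ^≈0⇒≈0 : ∀ k {x} → x ^ᵣ k ≈ 0# → x ≈ 0#
  ^≈0⇒≈0 zero    1≈0 = contradiction 1≈0 1≉0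
  ^≈0⇒≈0 (suc k) {x} x^k+1≈0 with x ≈? 0#
  ... | yes x≈0 = x≈0
  ... | no  x≉0 = ^≈0⇒≈0 k (*≈0⇒≈0 x≉0 x^k+1≈0)

  -- The `k`-th power of `p ×ᵣ 1#` is the order of the field times 1, hence zero, and a field has no
  -- nonzero nilpotent element.
  prime×1≈0 : ∀ p k → m ≡ p ^ k → p ×ᵣ 1# ≈ 0#
  prime×1≈0 p k ≡.refl = ^≈0⇒≈0 k (trans (sym (×1-homo-^ p k)) order×1≈0)

-- Fermat's little theorem for a finite field: raising to the order is the identity.

private
  module Fermat {m} (F : FiniteField c ℓ (suc m)) where

    open FiniteField F hiding (zero)
    open FiniteFieldProperties F
    open Inverse enumeration using (from-cong) renaming (to to element; from to index)
    open CommutativeMonoidSum *-commutativeMonoid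
      using (sum-permute; ∑-distrib-+; sum-cong-≋; sum-remove; sum-replicate)
      renaming (sum to product)
    open Exp commutativeSemiring using (^-congˡ) renaming (_^_ to _^ᵣ_)
    open SemiringProperties commutativeSemiring using (0^)
    open ≈-Reasoning setoid

    -- A product over the nonzero elements is encoded as a product over the whole enumeration, with
    -- the factor at zero replaced by the neutral 1.
    1-at-0 : (Carrier → Carrier) → Carrier → Carrier
    1-at-0 f x with x ≈? 0#
    ... | yes _ = 1#
    ... | no  _ = f x

    1-at-0-zero : ∀ f {x} → x ≈ 0# → 1-at-0 f x ≈ 1#
    1-at-0-zero f {x} x≈0 with x ≈? 0#
    ... | yes _   = refl
    ... | no  x≉0 = contradiction x≈0 x≉0

    1-at-0-nonzero : ∀ f {x} → x ≉ 0# → 1-at-0 f x ≈ f x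
    1-at-0-nonzero f {x} x≉0 with x ≈? 0#
    ... | yes x≈0 = contradiction x≈0 x≉0
    ... | no  _   = refl

    unit : Carrier → Carrier
    unit = 1-at-0 λ x → x

    unit-≉0 : ∀ x → unit x ≉ 0#
    unit-≉0 x with x ≈? 0#
    ... | yes _   = 1≉0
    ... | no  x≉0 = x≉0

    -- The permutation y ↦ x y of the nonzero elements multiplies their product by x^m.
    ^-order-nonzero : ∀ {x} → x ≉ 0# → x ^ᵣ suc m ≈ x
    ^-order-nonzero {x} x≉0 with x⁻¹ , x⁻¹x≈1 , xx⁻¹≈1 ← inverse x x≉0 = begin
      x * x ^ᵣ m       ≈⟨ *-congˡ x^m≈1 ⟩
      x * 1#           ≈⟨ *-identityʳ x ⟩
      x                ∎
      where
      undo : ∀ {y z} → y * z ≈ 1# → ∀ w → y * (z * w) ≈ w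
      undo yz≈1 w = trans (sym (*-assoc _ _ _)) (trans (*-congʳ yz≈1) (*-identityˡ w))

      multiply = bijection⇒permutation (x *_) (x⁻¹ *_) *-congˡ *-congˡ (undo xx⁻¹≈1) (undo x⁻¹x≈1)

      scaled : Carrier → Carrier
      scaled = 1-at-0 λ _ → x

      -- The separate variable `y` is there because the reindexed product contains
      -- `element (index (x * z))`, which agrees with `x * z` only up to `≈`.
      unit-scaled : ∀ y z → y ≈ x * z → unit y ≈ scaled z * unit z
      unit-scaled y z y≈xz with z ≈? 0#
      ... | yes z≈0 = trans (1-at-0-zero _ (trans y≈xz (trans (*-congˡ z≈0) (zeroʳ x)))) (sym (*-identityˡ 1#))
      ... | no  z≉0 = trans (1-at-0-nonzero _ (λ y≈0 → z≉0 (*≈0⇒≈0 x≉0 (trans (sym y≈xz) y≈0)))) y≈xz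

      -- Reindexing along `multiply` shows that the product of all `unit` values equals itself times
      -- the product of the factors `scaled`. The former is nonzero and cancels.
      product-scaled≈1 : product (scaled ∘ element) ≈ 1#
      product-scaled≈1 = *-cancelʳ (product-≉0 (unit ∘ element) (λ i → unit-≉0 _)) (begin
        product (scaled ∘ element) * product (unit ∘ element)
          ≈⟨ ∑-distrib-+ (scaled ∘ element) (unit ∘ element) ⟨
        product (λ i → scaled (element i) * unit (element i))
          ≈⟨ sum-cong-≋ (λ i → unit-scaled _ (element i) (element-index _)) ⟨
        product (λ i → unit (element (index (x * element i))))
          ≈⟨ sum-permute (unit ∘ element) multiply ⟨
        product (unit ∘ element)
          ≈⟨ *-identityˡ _ ⟨
        1# * product (unit ∘ element) ∎)

      0̂ = index 0#

      x^m≈1 : x ^ᵣ m ≈ 1#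
      -- Of the `m + 1` factors `scaled`, the one at the index of zero is 1. The remaining `m`
      -- belong to nonzero elements and equal `x`.
      x^m≈1 = begin
        x ^ᵣ m
          ≈⟨ sum-replicate m ⟨
        product (replicate m x)
          ≈⟨ sum-cong-≋ {m} (λ j → 1-at-0-nonzero _ (λ eq → punchInᵢ≢i 0̂ j (≡.trans (≡.sym (index-element _)) (from-cong eq)))) ⟨
        product (removeAt (scaled ∘ element) 0̂)
          ≈⟨ *-identityˡ _ ⟨
        1# * product (removeAt (scaled ∘ element) 0̂)
          ≈⟨ *-congʳ (1-at-0-zero _ (element-index 0#)) ⟨
        scaled (element 0̂) * product (removeAt (scaled ∘ element) 0̂)
          ≈⟨ sum-remove (scaled ∘ element) ⟨
        product (scaled ∘ element)
          ≈⟨ product-scaled≈1 ⟩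
        1# ∎

    ^-order : ∀ x → x ^ᵣ suc m ≈ x
    ^-order x with x ≈? 0#
    ... | yes x≈0 = trans (^-congˡ (suc m) x≈0) (trans (0^ (suc m)) (sym x≈0))
    ... | no  x≉0 = ^-order-nonzero x≉0

^-order : ∀ {m} (F : FiniteField c ℓ m) →
          let open FiniteField F; open Exp commutativeSemiring renaming (_^_ to _^ᵣ_) in
          ∀ x → x ^ᵣ m ≈ x
-- Order zero is impossible, as the index of `x` would lie in the empty `Fin 0`.
^-order {m = zero}  F x with () ← Inverse.from (FiniteField.enumeration F) x
^-order {m = suc m} F x = Fermat.^-order F x

-- The trace of the extension, coordinates with respect to dual bases, and evaluation of F.

module ExtensionProperties
  {k ℓk l ℓl : Level} {q n : ℕ} (q-primePower : PrimePower q)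
  (K : FiniteField k ℓk q) (L : FiniteField l ℓl (q ^ n))
  (ι : RingHomomorphism (FiniteField.rawRing K) (FiniteField.rawRing L))
  where

  private
    module K where
      open FiniteField K public
      open Exp commutativeSemiring public using () renaming (_^_ to _^ᵣ_)
  open FiniteField L hiding (zero)
  open Extension {n = n} K L ι
  open RingHomomorphism ι using (+-homo; *-homo; 0#-homo; 1#-homo)
    renaming (⟦_⟧ to embed; ⟦⟧-cong to embed-cong)
  open Sum semiring
  open Exp commutativeSemiring using (^-congˡ; ^-distrib-*) renaming (_^_ to _^ᵣ_)
  open SemiringProperties commutativeSemiring
  open GroupProperties +-group using (∙-cancelʳ)
  open ≈-Reasoning setoid

  private
    p = proj₁ q-primePower
    e = proj₁ (proj₂ q-primePower)
    p-prime : Prime p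
    p-prime = proj₁ (proj₂ (proj₂ q-primePower))
    q≡p^e : q ≡ p ^ e
    q≡p^e = proj₂ (proj₂ (proj₂ (proj₂ q-primePower)))

  -- Serves twice: at `i = n` it displays the order of the large field as a power of `p`, which
  -- yields the characteristic, and in general it makes the exponents of the trace iterated
  -- Frobenius exponents.
  q^i≡p^ei : ∀ i → q ^ i ≡ p ^ (e ℕ.* i)
  q^i≡p^ei i = ≡.trans (≡.cong (_^ i) q≡p^e) (ℕ.^-*-assoc p e i)

  open Characteristic p-prime (FiniteFieldProperties.prime×1≈0 L p (e ℕ.* n) (q^i≡p^ei n))

  ^q^-+ : ∀ i x y → (x + y) ^ᵣ (q ^ i) ≈ x ^ᵣ (q ^ i) + y ^ᵣ (q ^ i)
  ^q^-+ i x y = ≡.subst (λ m → (x + y) ^ᵣ m ≈ x ^ᵣ m + y ^ᵣ m) (≡.sym (q^i≡p^ei i))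
                  (frobenius^-+ (e ℕ.* i) x y)

  embed-^ : ∀ c m → embed (c K.^ᵣ m) ≈ embed c ^ᵣ m
  embed-^ c zero    = 1#-homo
  embed-^ c (suc m) = trans (*-homo c _) (*-congˡ (embed-^ c m))

  -- Fermat's theorem in the small field says that raising to the power `q` fixes `c`; the embedding
  -- carries this over, and iterates of the map fix the image as well.
  embed-^q^ : ∀ c i → embed c ^ᵣ (q ^ i) ≈ embed c
  embed-^q^ c = ^-fixed (trans (sym (embed-^ c q)) (embed-cong (^-order K c)))

  Tr-cong : Congruent _≈_ _≈_ Tr
  Tr-cong x≈y = sum-cong-≋ {n} λ i → ^-congˡ (q ^ toℕ i) x≈y

  Tr-+ : ∀ x y → Tr (x + y) ≈ Tr x + Tr y
  Tr-+ x y = trans (sum-cong-≋ {n} λ i → ^q^-+ (toℕ i) x y) (∑-distrib-+ {n} _ _)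

  Tr-embed* : ∀ c x → Tr (embed c * x) ≈ embed c * Tr x
  Tr-embed* c x = begin
    Tr (embed c * x)
      ≈⟨ sum-cong-≋ {n} (λ i → trans (^-distrib-* _ x (q ^ toℕ i)) (*-congʳ (embed-^q^ c (toℕ i)))) ⟩
    sum {n} (λ i → embed c * x ^ᵣ (q ^ toℕ i))
      ≈⟨ *-distribˡ-sum {n} _ _ ⟨
    embed c * Tr x ∎

  -- Follows from homogeneity with the scalar zero; it is the empty case of `Tr-sum`.
  Tr-0 : Tr 0# ≈ 0#
  Tr-0 = begin
    Tr 0#               ≈⟨ Tr-cong (trans (*-congʳ 0#-homo) (zeroˡ 0#)) ⟨
    Tr (embed K.0# * 0#) ≈⟨ Tr-embed* K.0# 0# ⟩
    embed K.0# * Tr 0#  ≈⟨ *-congʳ 0#-homo ⟩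
    0# * Tr 0#          ≈⟨ zeroˡ _ ⟩
    0#                  ∎

  Tr-sum : ∀ {m} (t : Vector Carrier m) → Tr (sum t) ≈ sum (λ j → Tr (t j))
  Tr-sum {zero}  t = Tr-0
  Tr-sum {suc m} t = trans (Tr-+ (t zero) _) (+-congˡ (Tr-sum (tail t)))

  linearCombination-cong : ∀ {c d} u → (∀ i → c i K.≈ d i) → linearCombination c u ≈ linearCombination d u
  linearCombination-cong u c≈d = sum-cong-≋ {n} λ i → *-congʳ (embed-cong (c≈d i))

  linearCombination-0 : ∀ u → linearCombination (replicate n K.0#) u ≈ 0#
  linearCombination-0 u = trans (sum-cong-≋ {n} λ i → trans (*-congʳ 0#-homo) (zeroˡ (u i)))
                                (sum-replicate-zero n)

  linearCombination-injective : ∀ {u} → LinearlyIndependent u → ∀ {c d} →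
    linearCombination c u ≈ linearCombination d u → ∀ i → c i K.≈ d i
  linearCombination-injective {u} independent {c} {d} cu≈du i =
    GroupProperties.x∙y⁻¹≈ε⇒x≈y K.+-group (c i) (d i) (independent (λ j → c j K.- d j) difference i)
    where
    difference : linearCombination (λ j → c j K.- d j) u ≈ 0#
    -- Adding the combination of `d` to both sides reduces the claim to `(c j - d j) + d j = c j` in
    -- the small field.
    difference = ∙-cancelʳ (linearCombination d u) _ _ (begin
      linearCombination (λ j → c j K.- d j) u + linearCombination d u
        ≈⟨ ∑-distrib-+ {n} _ _ ⟨
      sum (λ j → embed (c j K.- d j) * u j + embed (d j) * u j)
        ≈⟨ sum-cong-≋ (λ j → trans (sym (distribʳ (u j) _ _)) (*-congʳ (trans (sym (+-homo _ _))
             (embed-cong (GroupProperties.//-rightDividesˡ K.+-group (d j) (c j)))))) ⟩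
      linearCombination c u
        ≈⟨ cu≈du ⟩
      linearCombination d u
        ≈⟨ +-identityˡ _ ⟨
      0# + linearCombination d u ∎)

  Tr-dual-coordinate : ∀ {u v} → AreDualBases u v → ∀ c i → Tr (v i * linearCombination c u) ≈ embed (c i)
  Tr-dual-coordinate {u} {v} dual c i = begin
    Tr (v i * linearCombination c u)
      ≈⟨ Tr-cong (*-distribˡ-sum (v i) (λ j → embed (c j) * u j)) ⟩
    Tr (sum λ j → v i * (embed (c j) * u j))
      ≈⟨ Tr-sum {n} _ ⟩
    sum (λ j → Tr (v i * (embed (c j) * u j)))
      -- The scalar moves to the front for homogeneity, and `u j` before `v i` to match the order in
      -- `AreDualBases`.
      ≈⟨ sum-cong-≋ (λ j → trans (Tr-cong (x∙yz≈y∙zx (v i) (embed (c j)) (u j))) (Tr-embed* (c j) (u j * v i))) ⟩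
    sum (λ j → embed (c j) * Tr (u j * v i))
      ≈⟨ sum-single _ i (λ j i≢j → trans (*-congˡ (offDiagonal j i (i≢j ∘ ≡.sym))) (zeroʳ _)) ⟩
    embed (c i) * Tr (u i * v i)
      ≈⟨ *-congˡ (diagonal i) ⟩
    embed (c i) * 1#
      ≈⟨ *-identityʳ _ ⟩
    embed (c i) ∎
    where
    open AreDualBases dual
    open CommutativeSemigroupProperties *-commutativeSemigroup using (x∙yz≈y∙zx)

  open L[X]
  open PolynomialProperties commutativeSemiring
  private module K[X]ₚ = PolynomialProperties K.commutativeSemiring

  -- Lets `h i` act as a map of the small field, although inside `F` it is composed as a polynomial
  -- over the large one.
  ⟦baseChange⟧ : ∀ p c → ⟦ baseChange p ⟧ (embed c) ≈ embed (K[X].⟦ p ⟧ c)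
  ⟦baseChange⟧ []      c = sym 0#-homo
  ⟦baseChange⟧ (a ∷ p) c = begin
    embed a + embed c * ⟦ baseChange p ⟧ (embed c)  ≈⟨ +-congˡ (*-congˡ (⟦baseChange⟧ p c)) ⟩
    embed a + embed c * embed (K[X].⟦ p ⟧ c)        ≈⟨ +-congˡ (*-homo c _) ⟨
    embed a + embed (c K.* K[X].⟦ p ⟧ c)            ≈⟨ +-homo a _ ⟨
    embed (a K.+ c K.* K[X].⟦ p ⟧ c)                ∎

  -- Unfolds to the polynomial `F` of the theorem, and at `b`, `X`, `h⁻¹`, `u` to the inner sum of
  -- its inverse, so one evaluation lemma covers both.
  substituteCoordinates : (v : Vector Carrier n) → Poly → Vector K[X].Poly n → Vector Carrier n → Poly
  substituteCoordinates v f h a = sumₚ λ i → const (a i) *ₚ (baseChange (h i) ∘ₚ Trₚ (const (v i) *ₚ f))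

  -- The `i`-th trace recovers the coordinate `c i`, which lies in the small field, so `h i` acts on
  -- it there. Taking `c` with an equation, instead of computing it from `x`, permits any known
  -- expansion of the value of `f`.
  ⟦substituteCoordinates⟧ : ∀ {u v} → AreDualBases u v → ∀ f h a {x c} →
    ⟦ f ⟧ x ≈ linearCombination c u →
    ⟦ substituteCoordinates v f h a ⟧ x ≈ linearCombination (λ i → K[X].⟦ h i ⟧ (c i)) a
  ⟦substituteCoordinates⟧ {u} {v} dual f h a {x} {c} fx≈cu =
    trans (⟦sum⟧ {n} _ x) (sum-cong-≋ {n} λ i → begin
      ⟦ const (a i) *ₚ (baseChange (h i) ∘ₚ Trₚ (const (v i) *ₚ f)) ⟧ x
        ≈⟨ ⟦const*⟧ (a i) (baseChange (h i) ∘ₚ Trₚ (const (v i) *ₚ f)) x ⟩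
      a i * ⟦ baseChange (h i) ∘ₚ Trₚ (const (v i) *ₚ f) ⟧ x
        ≈⟨ *-congˡ (⟦∘⟧ (baseChange (h i)) _ x) ⟩
      a i * ⟦ baseChange (h i) ⟧ (⟦ Trₚ (const (v i) *ₚ f) ⟧ x)
        ≈⟨ *-congˡ (⟦⟧-cong (baseChange (h i)) (coordinate i)) ⟩
      a i * ⟦ baseChange (h i) ⟧ (embed (c i))
        ≈⟨ *-congˡ (⟦baseChange⟧ (h i) (c i)) ⟩
      a i * embed (K[X].⟦ h i ⟧ (c i))
        ≈⟨ *-comm _ _ ⟩
      embed (K[X].⟦ h i ⟧ (c i)) * a i ∎)
    where
    coordinate : ∀ i → ⟦ Trₚ (const (v i) *ₚ f) ⟧ x ≈ embed (c i)
    coordinate i = begin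
      ⟦ Trₚ (const (v i) *ₚ f) ⟧ x      ≈⟨ ⟦trace⟧ q n (const (v i) *ₚ f) x ⟩
      Tr (⟦ const (v i) *ₚ f ⟧ x)       ≈⟨ Tr-cong (⟦const*⟧ (v i) f x) ⟩
      Tr (v i * ⟦ f ⟧ x)                ≈⟨ Tr-cong (*-congˡ fx≈cu) ⟩
      Tr (v i * linearCombination c u)  ≈⟨ Tr-dual-coordinate dual c i ⟩
      embed (c i)                       ∎

  -- The permutation criterion in both directions, and the inverse of F.

  module _
    (u v : Vector Carrier n) (dual : AreDualBases u v)
    (f : Poly) (f-permutation : IsPermutationPolynomial f)
    (h : Vector K[X].Poly n) (a : Vector Carrier n)
    where

    private
      F = substituteCoordinates v f h a

      h∘ : Vector K.Carrier n → Vector K.Carrier n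
      h∘ c i = K[X].⟦ h i ⟧ (c i)

      u-independent : LinearlyIndependent u
      u-independent = proj₁ (AreDualBases.basisˡ dual)

      coordinates : ∀ x → ∃ λ c → linearCombination c u ≈ x
      coordinates = proj₂ (AreDualBases.basisˡ dual)

      ⟦F⟧ : ∀ {x c} → ⟦ f ⟧ x ≈ linearCombination c u → ⟦ F ⟧ x ≈ linearCombination (h∘ c) a
      ⟦F⟧ = ⟦substituteCoordinates⟧ dual f h a

      f-surjective : ∀ y → ∃ λ x → ⟦ f ⟧ x ≈ y
      f-surjective y = map₂ (λ fz≈y → fz≈y refl) (proj₂ f-permutation y)

    permutation⇒basis×permutations : IsPermutationPolynomial F →
      IsBasis a × (∀ i → K[X].IsPermutationPolynomial (h i))
    permutation⇒basis×permutations (F-injective , F-surjective) =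
      (a-independent , a-spanning) , λ i → h-injective i , λ y →
        map₂ (λ hx≈y z≈x → K.trans (K[X]ₚ.⟦⟧-cong (h i) z≈x) hx≈y) (h-surjective i y)
      where
      -- Surjectivity of `f` realises `c` and `d` as coordinates of values of `f`; `F` then takes
      -- equal values at the two preimages, which must coincide.
      h∘-injective : ∀ {c d} → linearCombination (h∘ c) a ≈ linearCombination (h∘ d) a → ∀ i → c i K.≈ d i
      h∘-injective {c} {d} eq
        with x , fx≈cu ← f-surjective (linearCombination c u)
           | y , fy≈du ← f-surjective (linearCombination d u) =
        let x≈y = F-injective (trans (⟦F⟧ fx≈cu) (trans eq (sym (⟦F⟧ fy≈du))))
        in linearCombination-injective u-independent
             (trans (sym fx≈cu) (trans (⟦⟧-cong f x≈y) fy≈du))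

      h-injective : ∀ i → Injective K._≈_ K._≈_ K[X].⟦ h i ⟧
      h-injective i {s} {t} hs≈ht =
        ≡.subst₂ K._≈_ (updateAt-updates i _) (updateAt-updates i _) (h∘-injective {at s} {at t}
          (linearCombination-cong a h∘-at) i)
        where
        -- All other coordinates are frozen at zero, so `at s` and `at t` agree off position `i`,
        -- while at `i` the assumption on `s` and `t` applies.
        at : K.Carrier → Vector K.Carrier n
        at s = updateAt (replicate n K.0#) i (λ _ → s)

        h∘-at : ∀ j → h∘ (at s) j K.≈ h∘ (at t) j
        h∘-at j with j ≟ i
        ... | yes ≡.refl = ≡.subst₂ (λ c d → K[X].⟦ h i ⟧ c K.≈ K[X].⟦ h i ⟧ d)
                             (≡.sym (updateAt-updates i _)) (≡.sym (updateAt-updates i _)) hs≈ht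
        ... | no  j≢i    = K[X]ₚ.⟦⟧-cong (h j) (K.reflexive
                             (≡.trans (updateAt-minimal j i _ j≢i) (≡.sym (updateAt-minimal j i _ j≢i))))

      h-surjective : ∀ i → StrictlySurjective K._≈_ K[X].⟦ h i ⟧
      h-surjective i = FiniteFieldProperties.injective⇒surjective K (K[X]ₚ.⟦⟧-cong (h i)) (h-injective i)

      a-spanning : Spanning a
      a-spanning y with x , Fx≈y ← F-surjective y with c , cu≈fx ← coordinates (⟦ f ⟧ x) =
        h∘ c , trans (sym (⟦F⟧ (sym cu≈fx))) (Fx≈y refl)

      -- Since `h i` may move zero, the zero vector as well as `d` is written as an image under
      -- `h∘`. The two preimages give the same combination, hence coincide, and applying `h i` again
      -- gives `d i = 0`.
      a-independent : LinearlyIndependent a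
      a-independent d da≈0 i = K.trans (K.sym (h-preimage d i))
        (K.trans (K[X]ₚ.⟦⟧-cong (h i) (h∘-injective da≈0a i)) (h-preimage _ i))
        where
        preimage : Vector K.Carrier n → Vector K.Carrier n
        preimage d i = proj₁ (h-surjective i (d i))

        h-preimage : ∀ d i → h∘ (preimage d) i K.≈ d i
        h-preimage d i = proj₂ (h-surjective i (d i))

        da≈0a : linearCombination (h∘ (preimage d)) a ≈ linearCombination (h∘ (preimage (replicate n K.0#))) a
        da≈0a = begin
          linearCombination (h∘ (preimage d)) a                    ≈⟨ linearCombination-cong a (h-preimage d) ⟩
          linearCombination d a                                    ≈⟨ da≈0 ⟩
          0#                                                       ≈⟨ linearCombination-0 a ⟨
          linearCombination (replicate n K.0#) a                   ≈⟨ linearCombination-cong a (h-preimage _) ⟨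
          linearCombination (h∘ (preimage (replicate n K.0#))) a   ∎

    basis×permutations⇒permutation : IsBasis a → (∀ i → K[X].IsPermutationPolynomial (h i)) →
      IsPermutationPolynomial F
    basis×permutations⇒permutation (a-independent , a-spanning) h-permutation = F-injective , F-surjective
      where
      F-injective : Injective _≈_ _≈_ ⟦ F ⟧
      F-injective {x} {y} Fx≈Fy
        with c , cu≈fx ← coordinates (⟦ f ⟧ x) | d , du≈fy ← coordinates (⟦ f ⟧ y) =
        let hc≈hd = linearCombination-injective a-independent
                      (trans (sym (⟦F⟧ (sym cu≈fx))) (trans Fx≈Fy (⟦F⟧ (sym du≈fy))))
            c≈d   = λ i → proj₁ (h-permutation i) (hc≈hd i)
        in proj₁ f-permutation (trans (sym cu≈fx) (trans (linearCombination-cong u c≈d) du≈fy))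

      F-surjective : ∀ y → ∃ λ x → ∀ {z} → z ≈ x → ⟦ F ⟧ z ≈ y
      -- The preimage is built backwards: coordinates of `y` in the basis `a`, then their preimages
      -- under the `h i`, then a preimage under `f` of the vector with these coordinates in `u`.
      F-surjective y with d , da≈y ← a-spanning y =
        let c         = λ i → proj₁ (proj₂ (h-permutation i) (d i))
            hc≈d      = λ i → proj₂ (proj₂ (h-permutation i) (d i)) K.refl
            x , fx≈cu = f-surjective (linearCombination c u)
        in x , λ z≈x → trans (⟦⟧-cong F z≈x)
                         (trans (⟦F⟧ fx≈cu) (trans (linearCombination-cong a hc≈d) da≈y))

    compositionalInverse : (f⁻¹ : Poly) → IsCompositionalInverse f f⁻¹ →
      (h⁻¹ : Vector K[X].Poly n) → (∀ i → K[X].IsCompositionalInverse (h i) (h⁻¹ i)) →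
      (b : Vector Carrier n) → AreDualBases a b →
      IsCompositionalInverse F (f⁻¹ ∘ₚ substituteCoordinates b X h⁻¹ u)
    compositionalInverse f⁻¹ f-inverse h⁻¹ h-inverse b a-dual = F∘G , G∘F
      where
      g = substituteCoordinates b X h⁻¹ u

      ⟦g⟧ : ∀ {x d} → x ≈ linearCombination d a → ⟦ g ⟧ x ≈ linearCombination (λ i → K[X].⟦ h⁻¹ i ⟧ (d i)) u
      ⟦g⟧ {x} x≈da = ⟦substituteCoordinates⟧ a-dual X h⁻¹ u (trans (⟦X⟧ x) x≈da)

      F∘G : ∀ {x y} → y ≈ ⟦ f⁻¹ ∘ₚ g ⟧ x → ⟦ F ⟧ y ≈ x
      F∘G {x} {y} y≈Gx with d , da≈x ← proj₂ (AreDualBases.basisˡ a-dual) x = begin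
        ⟦ F ⟧ y
          -- As `y` is the value of `f⁻¹` at `⟦ g ⟧ x`, applying `f` returns `⟦ g ⟧ x`, whose
          -- coordinates in `u` are the `h⁻¹ i` of those of `x` in `a`.
          ≈⟨ ⟦F⟧ (trans (proj₁ f-inverse (trans y≈Gx (⟦∘⟧ f⁻¹ g x))) (⟦g⟧ (sym da≈x))) ⟩
        linearCombination (λ i → K[X].⟦ h i ⟧ (K[X].⟦ h⁻¹ i ⟧ (d i))) a
          ≈⟨ linearCombination-cong a (λ i → proj₁ (h-inverse i) K.refl) ⟩
        linearCombination d a
          ≈⟨ da≈x ⟩
        x ∎

      G∘F : ∀ {x y} → y ≈ ⟦ F ⟧ x → ⟦ f⁻¹ ∘ₚ g ⟧ y ≈ x
      G∘F {x} {y} y≈Fx with c , cu≈fx ← coordinates (⟦ f ⟧ x) =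
        -- By the inverse law for `f` it suffices that `g` at `y` equals the value of `f` at `x`.
        trans (⟦∘⟧ f⁻¹ g y) (proj₂ f-inverse (begin
          ⟦ g ⟧ y
            ≈⟨ ⟦g⟧ (trans y≈Fx (⟦F⟧ (sym cu≈fx))) ⟩
          linearCombination (λ i → K[X].⟦ h⁻¹ i ⟧ (K[X].⟦ h i ⟧ (c i))) u
            ≈⟨ linearCombination-cong u (λ i → proj₂ (h-inverse i) K.refl) ⟩
          linearCombination c u
            ≈⟨ cu≈fx ⟩
          ⟦ f ⟧ x ∎))

theorem1p2 :
  {k ℓk l ℓl : Level} (q n : ℕ) → PrimePower q → 0 < n →
  (K : FiniteField k ℓk q) (L : FiniteField l ℓl (q ^ n))
  (ι : RingHomomorphism (FiniteField.rawRing K) (FiniteField.rawRing L)) →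
  let open Extension {n = n} K L ι
      open L[X]
  in
  (u v : Vector (FiniteField.Carrier L) n) → AreDualBases u v →
  (f : L[X].Poly) → L[X].IsPermutationPolynomial f →
  (h : Vector K[X].Poly n) (a : Vector (FiniteField.Carrier L) n) →
  let fᵢ = λ i → Trₚ (const (v i) *ₚ f)
      F  = sumₚ λ i → const (a i) *ₚ (baseChange (h i) ∘ₚ fᵢ i)
  in
  (L[X].IsPermutationPolynomial F
     ⇔ (IsBasis a × (∀ i → K[X].IsPermutationPolynomial (h i))))
  ×
  (IsBasis a → (∀ i → K[X].IsPermutationPolynomial (h i)) →
   (f⁻¹ : L[X].Poly) → L[X].IsCompositionalInverse f f⁻¹ →
   (h⁻¹ : Vector K[X].Poly n) → (∀ i → K[X].IsCompositionalInverse (h i) (h⁻¹ i)) →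
   (b : Vector (FiniteField.Carrier L) n) → AreDualBases a b →
   L[X].IsCompositionalInverse F
     (f⁻¹ ∘ₚ sumₚ λ i → const (u i) *ₚ (baseChange (h⁻¹ i) ∘ₚ Trₚ (const (b i) *ₚ X))))
theorem1p2 q n q-primePower 0<n K L ι u v dual f f-permutation h a =
  mk⇔ (permutation⇒basis×permutations u v dual f f-permutation h a)
      (λ (a-basis , h-permutation) →
        basis×permutations⇒permutation u v dual f f-permutation h a a-basis h-permutation)
  , λ _ _ → compositionalInverse u v dual f f-permutation h a
  where open ExtensionProperties {n = n} q-primePower K L ι
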